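{- Let $P$ be a hereditary property of graphs above the polynomial layer, i.e. whose speed is neither constant ($P_n=\Theta(1)$) nor polynomial ($P_n=n^{\Theta(1)}$). Then the speed of $P$ is exponential (that is, $P_n=2^{\Theta(n)}$) if and only if there is a constant $k$ such that every graph $G\in P$ has neighbourhood diversity $nd(G)\le k$.
   Context: All graphs are finite, simple and undirected. A graph property is an infinite class of graphs closed under isomorphism. A property is hereditary if it is closed under taking induced subgraphs. $P_n$ denotes the number of labelled graphs on the vertex set $\{1,\dots,n\}$ that belong to $P$; the function $n\mapsto P_n$ is the speed of $P$. Two vertices $x,y$ of a graph $G$ are similar if there is no vertex $z\notin\{x,y\}$ adjacent to exactly one of $x$ and $y$. Similarity is an equivalence relation on $V(G)$; the number of its equivalence classes is the neighbourhood diversity $nd(G)$. -}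

module Defs where

open import Data.Bool using (Bool; false)
import Data.Bool.Properties as Bool
open import Data.Fin using (Fin)
import Data.Fin.Properties as Fin
open import Data.List using (List; length; deduplicate; allFin)
open import Data.List.Relation.Unary.Any using (Any)
open import Data.Nat using (ℕ; _*_; _^_; _≤_; _<_)
open import Data.Product using (∃; Σ-syntax; ∃-syntax; _×_; _,_; proj₁)
open import Function using (_↔_; _↣_; Inverse; Injection; _on_)
open import Level using (Level; 0ℓ; suc)
open import Relation.Binary using (Rel; Decidable; Setoid; IsEquivalence)
open import Relation.Binary.PropositionalEquality
  using (_≡_; _≢_; refl; sym; trans; setoid)
open import Relation.Nullary using (¬_; ¬?)
open import Relation.Nullary.Decidable using (_×-dec_)

-- A labelled graph, with Fin n playing the role of {1,…,n}.
record Graph (n : ℕ) : Set where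
  field
    adj       : Fin n → Fin n → Bool
    symmetric : ∀ x y → adj x y ≡ adj y x
    loopless  : ∀ x → adj x x ≡ false

open Graph public

-- Equality of labelled graphs: the same edge set.
_≈ᴳ_ : ∀ {n} → Rel (Graph n) 0ℓ
G ≈ᴳ H = ∀ x y → adj G x y ≡ adj H x y

≈ᴳ-isEquivalence : ∀ {n} → IsEquivalence (_≈ᴳ_ {n})
≈ᴳ-isEquivalence = record
  { refl  = λ _ _ → refl
  ; sym   = λ p x y → sym (p x y)
  ; trans = λ p q x y → trans (p x y) (q x y)
  }

record _≅_ {m n : ℕ} (G : Graph m) (H : Graph n) : Set where
  field
    bijection : Fin m ↔ Fin n
    preserves : ∀ x y →
      adj G x y ≡ adj H (Inverse.to bijection x) (Inverse.to bijection y)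

-- The subgraph of G induced by the image of f, relabelled along f.
_[_] : ∀ {m n} → Graph n → (Fin m ↣ Fin n) → Graph m
G [ f ] = record
  { adj       = λ x y → adj G (to x) (to y)
  ; symmetric = λ x y → symmetric G (to x) (to y)
  ; loopless  = λ x → loopless G (to x)
  }
  where open Injection f using (to)

-- Infinite means: no finite list contains all members up to isomorphism.
record GraphProperty (ℓ : Level) : Set (suc ℓ) where
  field
    Member     : ∀ {n} → Graph n → Set ℓ
    iso-closed : ∀ {m n} {G : Graph m} {H : Graph n} →
                 G ≅ H → Member G → Member H
    infinite   : ¬ (Σ[ L ∈ List (∃ Graph) ]
                    (∀ {n} (G : Graph n) → Member G →
                     Any (λ (_ , H) → G ≅ H) L))

open GraphProperty public

_∈ᴾ_ : ∀ {ℓ n} → Graph n → GraphProperty ℓ → Set ℓ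
G ∈ᴾ P = Member P G

Hereditary : ∀ {ℓ} → GraphProperty ℓ → Set ℓ
Hereditary P = ∀ {m n} (G : Graph n) (f : Fin m ↣ Fin n) →
               G ∈ᴾ P → (G [ f ]) ∈ᴾ P

-- Membership proofs are ignored by the equality, so elements of this setoid
-- are labelled graphs, not graphs together with a proof.
labelledMembers : ∀ {ℓ} → GraphProperty ℓ → ℕ → Setoid ℓ 0ℓ
labelledMembers P n = record
  { Carrier       = Σ[ G ∈ Graph n ] G ∈ᴾ P
  ; _≈_           = _≈ᴳ_ on proj₁
  ; isEquivalence = record
    { refl  = λ {x} → E.refl {proj₁ x}
    ; sym   = λ {x} {y} → E.sym {proj₁ x} {proj₁ y}
    ; trans = λ {x} {y} {z} → E.trans {proj₁ x} {proj₁ y} {proj₁ z}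
    }
  }
  where module E = IsEquivalence (≈ᴳ-isEquivalence {n})

-- s n is the number Pₙ of labelled graphs on n vertices belonging to P.
-- The speed is a relation rather than a computed function because membership
-- in P is not assumed decidable; classically exactly one such s exists.
IsSpeed : ∀ {ℓ} → GraphProperty ℓ → (ℕ → ℕ) → Set ℓ
IsSpeed P s = ∀ n → Inverse (setoid (Fin (s n))) (labelledMembers P n)

-- f = Θ(g).  The positive real constant of the lower bound may be shrunk to
-- 1/a, and that of the upper bound increased to an integer c.
_≐Θ_ : (f g : ℕ → ℕ) → Set
f ≐Θ g = ∃[ a ] ∃[ c ] 0 < a × 0 < c × ∃[ N ] (∀ n → N ≤ n →
  g n ≤ a * f n × f n ≤ c * g n)

-- f = b^Θ(h), that is b^(h/a) ≤ f ≤ b^(c·h) eventually, for positive a and c;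
-- the first inequality is raised to the power a.
_≐_^Θ_ : (f b h : ℕ → ℕ) → Set
f ≐ b ^Θ h = ∃[ a ] ∃[ c ] 0 < a × 0 < c × ∃[ N ] (∀ n → N ≤ n →
  b n ^ h n ≤ f n ^ a × f n ≤ b n ^ (c * h n))

ConstantSpeed PolynomialSpeed ExponentialSpeed : (ℕ → ℕ) → Set
ConstantSpeed    s = s ≐Θ (λ _ → 1)
PolynomialSpeed  s = s ≐ (λ n → n) ^Θ (λ _ → 1)
ExponentialSpeed s = s ≐ (λ _ → 2) ^Θ (λ n → n)

Distinguishes : ∀ {n} (G : Graph n) (x y z : Fin n) → Set
Distinguishes G x y z = z ≢ x × z ≢ y × adj G z x ≢ adj G z y

Similar : ∀ {n} → Graph n → Rel (Fin n) 0ℓ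
Similar G x y = ¬ ∃ (Distinguishes G x y)

similar? : ∀ {n} (G : Graph n) → Decidable (Similar G)
similar? G x y = ¬? (Fin.any? λ z →
  ¬? (z Fin.≟ x) ×-dec ¬? (z Fin.≟ y) ×-dec ¬? (adj G z x Bool.≟ adj G z y))

-- The number of similarity classes: deduplicate keeps exactly one vertex from
-- each class.
nd : ∀ {n} → Graph n → ℕ
nd {n} G = length (deduplicate (similar? G) (allFin n))

{-# OPTIONS --safe #-}
module Submission where

-- If nd is large on P, repeated halving of a set of pairwise dissimilar vertices gives, for
-- every m, distinct vertices x₁,…,xₘ, y₁,…,yₘ of a member of P such that yᵢ separates xᵢ from
-- each later xⱼ.  Labelling the y's in order and the x's in any order yields m! labelled graphs
-- on 2m vertices, which outgrows 2^(cn).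
--
-- If nd ≤ k on P, a member is determined by a k-colouring of its vertices and a k×k matrix,
-- which gives the exponential upper bound.  For the lower bound, a vertex with m neighbours and
-- m non-neighbours yields 2^m labelled graphs on 1+m vertices.  If for some m there is no such
-- vertex, at most one similarity class exceeds m, so the speed is at most polynomial; it is
-- then at least linear as soon as non-homogeneous members exist in all sizes, since moving the
-- label of one exceptional vertex already gives n-1 labelled graphs, and bounded otherwise.

open import Defs
open import Data.Bool using (Bool; true; false; not; if_then_else_)
import Data.Bool.Properties as Bool
open import Data.Fin as Fin
  using (Fin; zero; suc; toℕ; inject≤; funToFin; finToFun; combine; remQuot; punchIn; splitAt; _↑ˡ_; _↑ʳ_)
import Data.Fin.Properties as Fin
open import Data.List using (List; []; _∷_; _++_; map; length; lookup; filter; deduplicate; allFin)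
import Data.List.Properties as List
open import Data.List.Membership.Propositional using (_∈_)
open import Data.List.Membership.Propositional.Properties using (∈-allFin; ∈-lookup; ∈-filter⁺; ∈-filter⁻)
open import Data.List.Relation.Unary.All as All using ([]; _∷_)
import Data.List.Relation.Unary.All.Properties as All
open import Data.List.Relation.Unary.AllPairs as AllPairs using (AllPairs; []; _∷_)
import Data.List.Relation.Unary.AllPairs.Properties as AllPairs
open import Data.List.Relation.Unary.Any as Any using (Any; here; there)
import Data.List.Relation.Unary.Any.Properties as Any
open import Data.List.Relation.Unary.Unique.Propositional using (Unique)
import Data.List.Relation.Unary.Unique.Propositional.Properties as Unique
open import Data.Nat as ℕ using (ℕ; zero; suc; _+_; _*_; _^_; _≤_; _<_; z≤n; s≤s; _!)
import Data.Nat.Properties as ℕ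
open import Data.Nat.Tactic.RingSolver using (solve-∀)
open import Data.Product using (∃; ∃-syntax; Σ-syntax; _×_; _,_; proj₁; proj₂)
open import Data.Sum using (_⊎_; inj₁; inj₂; [_,_]′)
open import Data.Vec.Functional using () renaming (_∷_ to _◂_)
open import Function using (_⇔_; _∘_; _↣_; Inverse; Injective; mk↣; mk↔ₛ′; mk⇔)
open import Relation.Binary using (Rel; Decidable; Reflexive; Symmetric; Transitive; tri<; tri≈; tri>)
open import Relation.Binary.PropositionalEquality
  using (_≡_; _≢_; _≗_; refl; sym; trans; cong; cong₂; subst; module ≡-Reasoning)
open import Relation.Nullary using (¬_; Dec; yes; no; does; ¬?; contradiction)
open import Relation.Nullary.Decidable using (_×-dec_; decidable-stable; dec-true)

-- Similarity of vertices

module _ {n} (G : Graph n) where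

  distinguishes? : ∀ x y z → Dec (Distinguishes G x y z)
  distinguishes? x y z =
    ¬? (z Fin.≟ x) ×-dec ¬? (z Fin.≟ y) ×-dec ¬? (adj G z x Bool.≟ adj G z y)

  dissimilar⇒distinguished : ∀ {x y} → ¬ Similar G x y → ∃ (Distinguishes G x y)
  dissimilar⇒distinguished {x} {y} = decidable-stable (Fin.any? (distinguishes? x y))

  similar-agree : ∀ {x y z} → Similar G x y → z ≢ x → z ≢ y → adj G z x ≡ adj G z y
  similar-agree x∼y z≢x z≢y =
    decidable-stable (_ Bool.≟ _) λ neq → x∼y (_ , z≢x , z≢y , neq)

  similar-refl : Reflexive (Similar G)
  similar-refl (_ , _ , _ , neq) = neq refl

  similar-sym : Symmetric (Similar G)
  similar-sym x∼y (z , z≢y , z≢x , neq) = x∼y (z , z≢x , z≢y , neq ∘ sym)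

  -- A vertex other than `y` agrees on `x` and `y` and on `y` and `z`. If the distinguishing vertex
  -- is `y` itself, the pair `y x` is compared with `x z` through `y∼z`, and that with `z y` through
  -- `x∼y`.
  similar-trans : Transitive (Similar G)
  similar-trans {x} {y} {z} x∼y y∼z (w , w≢x , w≢z , neq) with w Fin.≟ y
  ... | no w≢y = neq (trans (similar-agree x∼y w≢x w≢y) (similar-agree y∼z w≢y w≢z))
  ... | yes refl with x Fin.≟ z
  ...   | yes refl = neq refl
  ...   | no x≢z   = neq (begin
    adj G y x ≡⟨ symmetric G y x ⟩
    adj G x y ≡⟨ similar-agree y∼z (w≢x ∘ sym) x≢z ⟩
    adj G x z ≡⟨ symmetric G x z ⟩
    adj G z x ≡⟨ similar-agree x∼y (x≢z ∘ sym) (w≢z ∘ sym) ⟩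
    adj G z y ≡⟨ symmetric G z y ⟩
    adj G y z ∎)
    where open ≡-Reasoning

  -- The endpoints are replaced one at a time, in whichever order keeps the intermediate pair free
  -- of a loop. If neither order does, the two pairs are each other's reversal.
  similar-adj : ∀ {x x′ y y′} → Similar G x x′ → Similar G y y′ →
                x ≢ y → x′ ≢ y′ → adj G x y ≡ adj G x′ y′
  similar-adj {x} {x′} {y} {y′} x∼x′ y∼y′ x≢y x′≢y′ with y Fin.≟ x′ | x Fin.≟ y′
  ... | no y≢x′ | _ = begin
    adj G x y   ≡⟨ symmetric G x y ⟩
    adj G y x   ≡⟨ similar-agree x∼x′ (x≢y ∘ sym) y≢x′ ⟩
    adj G y x′  ≡⟨ symmetric G y x′ ⟩
    adj G x′ y  ≡⟨ similar-agree y∼y′ (y≢x′ ∘ sym) x′≢y′ ⟩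
    adj G x′ y′ ∎
    where open ≡-Reasoning
  ... | yes _ | no x≢y′ = begin
    adj G x y   ≡⟨ similar-agree y∼y′ x≢y x≢y′ ⟩
    adj G x y′  ≡⟨ symmetric G x y′ ⟩
    adj G y′ x  ≡⟨ similar-agree x∼x′ (x≢y′ ∘ sym) (x′≢y′ ∘ sym) ⟩
    adj G y′ x′ ≡⟨ symmetric G y′ x′ ⟩
    adj G x′ y′ ∎
    where open ≡-Reasoning
  ... | yes refl | yes refl = symmetric G x y

-- Representatives and colourings by similarity class

module _ {a r} {A : Set a} {R : Rel A r} where

  AllPairs-lookup : Symmetric R → ∀ {xs} → AllPairs R xs →
                    ∀ {i j} → i ≢ j → R (lookup xs i) (lookup xs j)
  AllPairs-lookup R-sym (_ ∷ _) {zero} {zero} i≢j = contradiction refl i≢j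
  AllPairs-lookup R-sym (px ∷ _) {zero} {suc j} _ = All.lookup px (∈-lookup j)
  AllPairs-lookup R-sym (px ∷ _) {suc i} {zero} _ = R-sym (All.lookup px (∈-lookup i))
  AllPairs-lookup R-sym (_ ∷ p) {suc i} {suc j} i≢j = AllPairs-lookup R-sym p (i≢j ∘ cong suc)

  deduplicate-AllPairs : (R? : Decidable R) → ∀ xs →
                         AllPairs (λ x y → ¬ R x y) (deduplicate R? xs)
  deduplicate-AllPairs R? []       = []
  deduplicate-AllPairs R? (x ∷ xs) =
    All.all-filter (¬? ∘ R? x) (deduplicate R? xs) ∷
    AllPairs.filter⁺ (¬? ∘ R? x) (deduplicate-AllPairs R? xs)

representatives : ∀ {n} → Graph n → List (Fin n)
representatives {n} G = deduplicate (similar? G) (allFin n)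

representatives-dissimilar : ∀ {n} (G : Graph n) →
                             AllPairs (λ x y → ¬ Similar G x y) (representatives G)
representatives-dissimilar {n} G = deduplicate-AllPairs (similar? G) (allFin n)

record ClassColouring {n} (k : ℕ) (G : Graph n) : Set where
  field
    colour         : Fin n → Fin k
    colour⇒similar : ∀ {x y} → colour x ≡ colour y → Similar G x y
    similar⇒colour : ∀ {x y} → Similar G x y → colour x ≡ colour y

classColouring : ∀ {n k} (G : Graph n) → nd G ≤ k → ClassColouring k G
classColouring {n} G nd≤k = record
  { colour         = λ x → inject≤ (class x) nd≤k
  ; colour⇒similar = λ {x} {y} eq → same (Fin.inject≤-injective nd≤k nd≤k _ _ eq)
  ; similar⇒colour = λ x∼y → cong (λ i → inject≤ i nd≤k) (merge x∼y)
  }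
  where
  represented : ∀ x → Any (λ r → Similar G r x) (representatives G)
  represented x = Any.deduplicate⁺ (similar? G) (λ z∼y y∼x → similar-trans G z∼y y∼x)
    (Any.map (λ { refl → similar-refl G }) (∈-allFin x))

  class : Fin n → Fin (nd G)
  class x = Any.index (represented x)

  rep : Fin n → Fin n
  rep x = lookup (representatives G) (class x)

  rep∼ : ∀ x → Similar G (rep x) x
  rep∼ x = Any.lookup-index (represented x)

  same : ∀ {x y} → class x ≡ class y → Similar G x y
  same {x} {y} eq = similar-trans G (similar-sym G (rep∼ x))
    (subst (λ i → Similar G (lookup (representatives G) i) y) (sym eq) (rep∼ y))

  merge : ∀ {x y} → Similar G x y → class x ≡ class y
  merge {x} {y} x∼y = decidable-stable (class x Fin.≟ class y) λ x≢y →
    AllPairs-lookup (λ ¬s s → ¬s (similar-sym G s)) (representatives-dissimilar G) x≢y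
      (similar-trans G (rep∼ x) (similar-trans G x∼y (similar-sym G (rep∼ y))))

open ClassColouring

-- The quotient matrix

module _ {n k} {G : Graph n} (C : ClassColouring k G) where

  quotient-edge? : ∀ a b → Dec (∃[ x ] ∃[ y ]
    x ≢ y × colour C x ≡ a × colour C y ≡ b × adj G x y ≡ true)
  quotient-edge? a b = Fin.any? λ x → Fin.any? λ y →
    ¬? (x Fin.≟ y) ×-dec (colour C x Fin.≟ a) ×-dec (colour C y Fin.≟ b)
      ×-dec (adj G x y Bool.≟ true)

  -- A diagonal entry tells whether a class is a clique or edgeless; it is `false` for classes with
  -- fewer than two vertices.
  quotient : Fin k → Fin k → Bool
  quotient a b = does (quotient-edge? a b)

  adj-quotient : ∀ {x y} → x ≢ y → adj G x y ≡ quotient (colour C x) (colour C y)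
  adj-quotient {x} {y} x≢y with quotient-edge? (colour C x) (colour C y)
  ... | yes (x′ , y′ , x′≢y′ , x≡ , y≡ , e) =
    trans (similar-adj G (colour⇒similar C (sym x≡)) (colour⇒similar C (sym y≡)) x≢y x′≢y′) e
  ... | no ¬e = Bool.¬-not λ e → ¬e (x , y , x≢y , refl , refl , e)

quotient-determines : ∀ {n k} {G H : Graph n}
  (C : ClassColouring k G) (D : ClassColouring k H) → colour C ≗ colour D →
  (∀ a b → quotient C a b ≡ quotient D a b) → G ≈ᴳ H
quotient-determines {G = G} {H} C D colour≗ quotient≗ x y with x Fin.≟ y
... | yes refl = trans (loopless G x) (sym (loopless H x))
... | no x≢y   = begin
  adj G x y                           ≡⟨ adj-quotient C x≢y ⟩
  quotient C (colour C x) (colour C y) ≡⟨ quotient≗ _ _ ⟩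
  quotient D (colour C x) (colour C y) ≡⟨ cong₂ (quotient D) (colour≗ x) (colour≗ y) ⟩
  quotient D (colour D x) (colour D y) ≡⟨ adj-quotient D x≢y ⟨
  adj H x y                           ∎
  where open ≡-Reasoning

-- Functions and matrices as numbers

funToFin-injective : ∀ {m n} {f g : Fin m → Fin n} → funToFin f ≡ funToFin g → f ≗ g
funToFin-injective {f = f} {g} eq i = begin
  f i                     ≡⟨ Fin.finToFun-funToFin f i ⟨
  finToFun (funToFin f) i ≡⟨ cong (λ c → finToFun c i) eq ⟩
  finToFun (funToFin g) i ≡⟨ Fin.finToFun-funToFin g i ⟩
  g i                     ∎
  where open ≡-Reasoning

matrixToFin : ∀ {k l m} → (Fin k → Fin l → Fin m) → Fin ((m ^ l) ^ k)
matrixToFin M = funToFin (funToFin ∘ M)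

matrixToFin-injective : ∀ {k l m} {M N : Fin k → Fin l → Fin m} →
                        matrixToFin M ≡ matrixToFin N → ∀ a b → M a b ≡ N a b
matrixToFin-injective eq a = funToFin-injective (funToFin-injective eq a)

boolToFin : Bool → Fin 2
boolToFin false = zero
boolToFin true  = suc zero

boolToFin-injective : Injective _≡_ _≡_ boolToFin
boolToFin-injective {false} {false} _ = refl
boolToFin-injective {true}  {true}  _ = refl

quotientCode : ∀ {n k} {G : Graph n} → ClassColouring k G → Fin ((2 ^ k) ^ k)
quotientCode C = matrixToFin λ a b → boolToFin (quotient C a b)

quotientCode-injective : ∀ {n k} {G H : Graph n} (C : ClassColouring k G)
  (D : ClassColouring k H) → quotientCode C ≡ quotientCode D →
  ∀ a b → quotient C a b ≡ quotient D a b
quotientCode-injective C D eq a b = boolToFin-injective (matrixToFin-injective eq a b)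

≅-of-≈ᴳ : ∀ {n} {G H : Graph n} → G ≈ᴳ H → G ≅ H
≅-of-≈ᴳ G≈H = record
  { bijection = mk↔ₛ′ (λ x → x) (λ x → x) (λ _ → refl) (λ _ → refl)
  ; preserves = G≈H
  }

-- Halving a list of vertices

module _ {a} {A : Set a} (f : A → Bool) where

  fibre : Bool → List A → List A
  fibre b = filter (λ x → f x Bool.≟ b)

  length-fibres : ∀ xs → length xs ≡ length (fibre true xs) + length (fibre false xs)
  length-fibres [] = refl
  length-fibres (x ∷ xs) with f x
  ... | true  = cong suc (length-fibres xs)
  ... | false = trans (cong suc (length-fibres xs)) (sym (ℕ.+-suc _ _))

  -- Two fibres with fewer than `m` elements each leave the length two short of `m + m`. The `suc`
  -- in the hypothesis uses this slack to pay for a vertex deleted by `remove`.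
  large-fibre : ∀ {m} xs → m + m ≤ suc (length xs) → ∃[ b ] m ≤ length (fibre b xs)
  large-fibre {m} xs 2m≤ with m ℕ.≤? length (fibre true xs) | m ℕ.≤? length (fibre false xs)
  ... | yes m≤ | _      = true , m≤
  ... | no _   | yes m≤ = false , m≤
  ... | no m≰  | no m≰′ = contradiction 2m≤ (ℕ.<⇒≱ (begin-strict
    suc (length xs)           ≡⟨ cong suc (length-fibres xs) ⟩
    suc (t + f′)              <⟨ ℕ.≤-reflexive (sym (cong suc (ℕ.+-suc t f′))) ⟩
    suc t + suc f′            ≤⟨ ℕ.+-mono-≤ (ℕ.≰⇒> m≰) (ℕ.≰⇒> m≰′) ⟩
    m + m                     ∎))
    where
    open ℕ.≤-Reasoning
    t  = length (fibre true xs)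
    f′ = length (fibre false xs)

module _ {n} (z : Fin n) where

  apart? : ∀ x → Dec (x ≢ z)
  apart? x = ¬? (x Fin.≟ z)

  remove : List (Fin n) → List (Fin n)
  remove = filter apart?

  length-remove : ∀ {xs} → Unique xs → length xs ≤ suc (length (remove xs))
  length-remove {[]} _ = z≤n
  length-remove {x ∷ xs} (x∉ ∷ u) with x Fin.≟ z
  ... | no _     = s≤s (length-remove u)
  ... | yes refl = ℕ.≤-reflexive (cong (suc ∘ length)
    (sym (List.filter-all apart? (All.map (λ x≢y y≡x → x≢y (sym y≡x)) x∉))))

-- Tables of the small classes

-- zero marks the positions beyond the end of the list.
entry : ∀ {n} → List (Fin n) → ℕ → Fin (suc n)
entry []       _       = zero
entry (x ∷ xs) zero    = suc x
entry (x ∷ xs) (suc i) = entry xs i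

entry-∈ : ∀ {n} (xs : List (Fin n)) i {x} → entry xs i ≡ suc x → x ∈ xs
entry-∈ (x ∷ xs) zero    refl = here refl
entry-∈ (x ∷ xs) (suc i) eq   = there (entry-∈ xs i eq)

∈-entry : ∀ {n} {xs : List (Fin n)} {x} → x ∈ xs → ∀ {m} → length xs ≤ m →
          Σ[ i ∈ Fin m ] entry xs (toℕ i) ≡ suc x
∈-entry (here refl) (s≤s _)  = zero , refl
∈-entry (there x∈)  (s≤s le) with i , eq ← ∈-entry x∈ le = suc i , eq

module _ {n k} {G : Graph n} (C : ClassColouring k G) where

  colourClass : Fin k → List (Fin n)
  colourClass a = filter (λ x → colour C x Fin.≟ a) (allFin n)

  colourClass-unique : ∀ a → Unique (colourClass a)
  colourClass-unique a = Unique.filter⁺ _ (Unique.allFin⁺ n)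

  SmallApartFrom : Fin k → ℕ → Set
  SmallApartFrom big m = ∀ a → a ≢ big → length (colourClass a) ≤ m

  classTable : ∀ m → Fin k → Fin m → Fin (suc n)
  classTable m a i = entry (colourClass a) (toℕ i)

-- The class of `x` in `G` fits into its row, so `x` occurs there; the equal row of `D` then lists
-- `x` under the same colour.
classTable-colour : ∀ {n k m big} {G H : Graph n} (C : ClassColouring k G) (D : ClassColouring k H) →
  SmallApartFrom C big m → (∀ a i → classTable C m a i ≡ classTable D m a i) →
  ∀ {x} → colour C x ≢ big → colour D x ≡ colour C x
classTable-colour C D small table {x} x≢big
  with i , eq ← ∈-entry (∈-filter⁺ (λ y → colour C y Fin.≟ colour C x) (∈-allFin x) refl)
                        (small (colour C x) x≢big)
  = proj₂ (∈-filter⁻ _ {xs = allFin _} (entry-∈ _ (toℕ i) (trans (sym (table (colour C x) i)) eq)))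

-- The table lists the small classes in full; the class of colour big, whose row is cut off, is
-- their complement.
classTable-determines : ∀ {n k m big} {G H : Graph n} (C : ClassColouring k G) (D : ClassColouring k H) →
  SmallApartFrom C big m → SmallApartFrom D big m →
  (∀ a i → classTable C m a i ≡ classTable D m a i) → colour C ≗ colour D
classTable-determines {big = big} C D smallC smallD table x
  with colour C x Fin.≟ big | colour D x Fin.≟ big
... | no x≢big | _        = sym (classTable-colour C D smallC table x≢big)
... | yes _    | no x≢big = classTable-colour D C smallD (λ a i → sym (table a i)) x≢big
... | yes p    | yes q    = trans p (sym q)

-- Fans of neighbours or non-neighbours of one vertex

record Fan {n} (G : Graph n) (z : Fin n) (b : Bool) (m : ℕ) : Set where
  field
    tip       : Fin m → Fin n
    injective : Injective _≡_ _≡_ tip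
    tip≢      : ∀ i → tip i ≢ z
    adj-tip   : ∀ i → adj G z (tip i) ≡ b

open Fan

fan : ∀ {n} {G : Graph n} {z b m} {xs : List (Fin n)} → Unique xs → m ≤ length xs →
      (∀ {x} → x ∈ xs → x ≢ z × adj G z x ≡ b) → Fan G z b m
fan {xs = xs} unique m≤ spoke = record
  { tip       = tip′
  ; injective = λ eq → Fin.inject≤-injective m≤ m≤ _ _ (decidable-stable (_ Fin.≟ _)
      λ i≢j → AllPairs-lookup (_∘ sym) unique i≢j eq)
  ; tip≢      = λ i → proj₁ (spoke (∈-lookup (inject≤ i m≤)))
  ; adj-tip   = λ i → proj₂ (spoke (∈-lookup (inject≤ i m≤)))
  }
  where
  tip′ : Fin _ → Fin _
  tip′ i = lookup xs (inject≤ i m≤)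

-- Thus `z` has `m` neighbours and `m` non-neighbours; `b` leaves open which fan comes first.
TwoFans : ∀ {n} → Graph n → ℕ → Set
TwoFans G m = ∃[ z ] ∃[ b ] Fan G z b m × Fan G z (not b) m

nonempty : ∀ {a} {A : Set a} {xs : List A} {m} → m < length xs → ∃ (_∈ xs)
nonempty {xs = x ∷ xs} _ = x , here refl

-- A vertex `z` distinguishing representatives of the two classes is constant on each class, with
-- opposite values. It may belong to one of them and is then dropped, hence the strict inequalities.
large-classes⇒twoFans : ∀ {n k m} {G : Graph n} (C : ClassColouring k G) {a b} → a ≢ b →
  m < length (colourClass C a) → m < length (colourClass C b) → TwoFans G m
large-classes⇒twoFans {m = m} {G} C {a} {b} a≢b m<a m<b
  with x , x∈ ← nonempty m<a | y , y∈ ← nonempty m<b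
  with refl ← proj₂ (∈-filter⁻ (λ v → colour C v Fin.≟ a) {xs = allFin _} x∈)
     | refl ← proj₂ (∈-filter⁻ (λ v → colour C v Fin.≟ b) {xs = allFin _} y∈)
  with z , z≢x , z≢y , neq ← dissimilar⇒distinguished G (λ x∼y → a≢b (similar⇒colour C x∼y))
  = z , adj G z x , classFan z≢x refl m<a , classFan z≢y (Bool.¬-not (neq ∘ sym)) m<b
  where
  classFan : ∀ {z v c} → z ≢ v → adj G z v ≡ c →
             m < length (colourClass C (colour C v)) → Fan G z c m
  classFan {z} {v} z≢v adj≡ m< = fan (Unique.filter⁺ (apart? z) (colourClass-unique C _))
    (ℕ.s≤s⁻¹ (ℕ.≤-trans m< (length-remove z (colourClass-unique C _))))
    λ w∈ → let w∈class , w≢z = ∈-filter⁻ (apart? z) {xs = colourClass C _} w∈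
               _ , eq = ∈-filter⁻ (λ u → colour C u Fin.≟ colour C v) {xs = allFin _} w∈class
           in w≢z , trans (similar-agree G (colour⇒similar C eq) (w≢z ∘ sym) z≢v) adj≡

dominant-class : ∀ {n k m} {G : Graph n} → 0 < n → ¬ TwoFans G m → (C : ClassColouring k G) →
                 ∃[ big ] SmallApartFrom C big m
dominant-class {suc _} {m = m} _ ¬fans C with Fin.any? (λ a → m ℕ.<? length (colourClass C a))
... | yes (big , m<) = big , λ a a≢big → ℕ.≮⇒≥ λ m<a → ¬fans (large-classes⇒twoFans C a≢big m<a m<)
-- Without a large class any colour serves; the vertex `zero` provides one.
... | no  ¬large     = colour C zero , λ a _ → ℕ.≮⇒≥ λ m<a → ¬large (a , m<a)

-- The more frequent adjacency value at `z` gives the fan, and one of `x` and `y` has the other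
-- value.
distinguished⇒fan : ∀ {n m} {G : Graph n} {x y z} → m + m < n → Distinguishes G x y z →
  ∃[ b ] Fan G z b m × Σ[ v ∈ Fin n ] v ≢ z × adj G z v ≡ not b
distinguished⇒fan {n} {m} {G} {x} {y} {z} 2m<n (z≢x , z≢y , neq)
  with b , m≤ ← large-fibre (adj G z) {m} (remove z (allFin n))
         (ℕ.≤-trans (ℕ.<⇒≤ 2m<n)
           (subst (_≤ suc (length (remove z (allFin n)))) (List.length-tabulate (λ i → i))
             (length-remove z (Unique.allFin⁺ n))))
  = b , fan (Unique.filter⁺ _ (Unique.filter⁺ _ (Unique.allFin⁺ n))) m≤ (λ w∈ →
      let w∈rest , eq = ∈-filter⁻ (λ w → adj G z w Bool.≟ b) {xs = remove z (allFin n)} w∈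
      in proj₂ (∈-filter⁻ (apart? z) {xs = allFin n} w∈rest) , eq)
  , opposite
  where
  opposite : Σ[ v ∈ Fin n ] v ≢ z × adj G z v ≡ not b
  opposite with adj G z x Bool.≟ not b
  ... | yes eq = x , z≢x ∘ sym , eq
  ... | no ¬eq = y , z≢y ∘ sym , trans (Bool.¬-not (neq ∘ sym))
    (cong not (trans (Bool.¬-not ¬eq) (Bool.not-involutive b)))

-- Separated sequences among dissimilar vertices

record Separated {n} (G : Graph n) (S : List (Fin n)) (r : ℕ) : Set where
  field
    x y         : Fin r → Fin n
    x∈          : ∀ i → x i ∈ S
    x-injective : Injective _≡_ _≡_ x
    y-injective : Injective _≡_ _≡_ y
    y≢x         : ∀ i j → y i ≢ x j
    separates   : ∀ {i j} → i Fin.< j → adj G (y i) (x i) ≢ adj G (y i) (x j)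
    -- A vertex constant on `S` can be put in front of the sequence without repeating any `y i`.
    splits      : ∀ i → ∃[ u ] ∃[ v ] u ∈ S × v ∈ S × adj G (y i) u ≢ adj G (y i) v

-- Two halvings per step give the factor four; the added 2 guarantees a dissimilar pair to start
-- from.
separableSize : ℕ → ℕ
separableSize zero    = 0
separableSize (suc r) = 2 + ((separableSize r + separableSize r) + (separableSize r + separableSize r))

-- Two dissimilar vertices s, s′ of S are separated by some y.  Passing to the larger half of
-- S∖{y} with respect to y loses s or s′, which becomes x; then pass to the larger half with
-- respect to x.  Neither x nor y splits what remains, so they differ from all later choices.
separate : ∀ {n} (G : Graph n) r (S : List (Fin n)) → AllPairs (λ u v → ¬ Similar G u v) S →
           separableSize r ≤ length S → Separated G S r
separate G zero S _ _ = record
  { x = λ () ; y = λ () ; x∈ = λ () ; x-injective = λ { {()} } ; y-injective = λ { {()} }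
  ; y≢x = λ () ; separates = λ { {()} } ; splits = λ () }
separate {n} G (suc r) (_ ∷ []) _ (s≤s ())
separate {n} G (suc r) S@(s ∷ s′ ∷ _) dissimilar@((s≁s′ ∷ _) ∷ _) size
  with y₀ , y₀≢s , y₀≢s′ , neq ← dissimilar⇒distinguished G s≁s′
  with b , half ← large-fibre (adj G y₀) {separableSize r + separableSize r} (remove y₀ S)
    (ℕ.≤-trans (ℕ.<⇒≤ (ℕ.<⇒≤ size))
      (length-remove y₀ (AllPairs.map (λ { ≁ refl → ≁ (similar-refl G) }) dissimilar)))
  = proceed (other (adj G y₀ s Bool.≟ b))
  where
  other : Dec (adj G y₀ s ≡ b) → ∃[ x₀ ] x₀ ∈ S × y₀ ≢ x₀ × adj G y₀ x₀ ≢ b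
  other (yes s≡b) = s′ , there (here refl) , y₀≢s′ , λ s′≡b → neq (trans s≡b (sym s′≡b))
  other (no s≢b)  = s , here refl , y₀≢s , s≢b

  proceed : ∃[ x₀ ] x₀ ∈ S × y₀ ≢ x₀ × adj G y₀ x₀ ≢ b → Separated G S (suc r)
  proceed (x₀ , x₀∈S , y₀≢x₀ , x₀≢b)
    with b′ , quarter ← large-fibre (adj G x₀) {separableSize r}
      (fibre (adj G y₀) b (remove y₀ S)) (ℕ.m≤n⇒m≤1+n half)
    = record
    { x           = x₀ ◂ x
    ; y           = y₀ ◂ y
    ; x∈          = λ { zero → x₀∈S ; (suc i) → proj₁ (kept (x∈ i)) }
    ; x-injective = λ { {zero} {zero} _ → refl
                      ; {zero} {suc j} x₀≡ → contradiction x₀≡ (x₀∉T (x∈ j))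
                      ; {suc i} {zero} ≡x₀ → contradiction (sym ≡x₀) (x₀∉T (x∈ i))
                      ; {suc i} {suc j} eq → cong suc (x-injective eq) }
    ; y-injective = λ { {zero} {zero} _ → refl
                      ; {zero} {suc j} y₀≡ → contradiction y₀≡ (y₀-constant (splits j))
                      ; {suc i} {zero} ≡y₀ → contradiction (sym ≡y₀) (y₀-constant (splits i))
                      ; {suc i} {suc j} eq → cong suc (y-injective eq) }
    ; y≢x         = λ { zero zero → y₀≢x₀
                      ; zero (suc j) y₀≡ → proj₁ (proj₂ (kept (x∈ j))) (sym y₀≡)
                      ; (suc i) zero ≡x₀ → x₀-constant (splits i) (sym ≡x₀)
                      ; (suc i) (suc j) → y≢x i j }
    -- All later `x` were kept for having the value `b` at `y₀`, which `x₀` does not have.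
    ; separates   = λ { {zero} {suc j} _ eq → x₀≢b (trans eq (proj₁ (proj₂ (proj₂ (kept (x∈ j))))))
                      ; {suc i} {suc j} (s≤s i<j) → separates i<j }
    ; splits      = λ { zero → s , s′ , here refl , there (here refl) , neq
                      ; (suc i) → let u , v , u∈ , v∈ , u≢v = splits i
                                  in u , v , proj₁ (kept u∈) , proj₁ (kept v∈) , u≢v }
    }
    where
    T : List (Fin n)
    T = fibre (adj G x₀) b′ (fibre (adj G y₀) b (remove y₀ S))

    kept : ∀ {w} → w ∈ T → w ∈ S × w ≢ y₀ × adj G y₀ w ≡ b × adj G x₀ w ≡ b′
    kept w∈T =
      let w∈₁ , x₀w = ∈-filter⁻ (λ w → adj G x₀ w Bool.≟ b′) {xs = fibre (adj G y₀) b (remove y₀ S)} w∈T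
          w∈₂ , y₀w = ∈-filter⁻ (λ w → adj G y₀ w Bool.≟ b) {xs = remove y₀ S} w∈₁
          w∈S , w≢y₀ = ∈-filter⁻ (apart? y₀) {xs = S} w∈₂
      in w∈S , w≢y₀ , y₀w , x₀w

    x₀∉T : ∀ {w} → w ∈ T → x₀ ≢ w
    x₀∉T w∈T refl = x₀≢b (proj₁ (proj₂ (proj₂ (kept w∈T))))

    SplitsT : Fin n → Set
    SplitsT w = ∃[ u ] ∃[ v ] u ∈ T × v ∈ T × adj G w u ≢ adj G w v

    y₀-constant : ∀ {w} → SplitsT w → y₀ ≢ w
    y₀-constant (_ , _ , u∈ , v∈ , u≢v) refl = u≢v
      (trans (proj₁ (proj₂ (proj₂ (kept u∈)))) (sym (proj₁ (proj₂ (proj₂ (kept v∈))))))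

    x₀-constant : ∀ {w} → SplitsT w → x₀ ≢ w
    x₀-constant (_ , _ , u∈ , v∈ , u≢v) refl = u≢v
      (trans (proj₂ (proj₂ (proj₂ (kept u∈)))) (sym (proj₂ (proj₂ (proj₂ (kept v∈))))))

    open Separated (separate G r T
      (AllPairs.filter⁺ (λ w → adj G x₀ w Bool.≟ b′)
        (AllPairs.filter⁺ (λ w → adj G y₀ w Bool.≟ b) (AllPairs.filter⁺ (apart? y₀) dissimilar)))
      quarter)

-- Coding permutations

-- This decodes a Lehmer code: the first digit is the image of `zero`, and `punchIn` makes the
-- remaining images avoid it.
permutation : ∀ n → Fin (n !) → Fin n → Fin n
permutation (suc n) c zero    = proj₁ (remQuot (n !) c)
permutation (suc n) c (suc i) =
  punchIn (proj₁ (remQuot (n !) c)) (permutation n (proj₂ (remQuot {suc n} (n !) c)) i)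

permutation-injective : ∀ n c → Injective _≡_ _≡_ (permutation n c)
permutation-injective (suc n) c {zero}  {zero}  _  = refl
permutation-injective (suc n) c {zero}  {suc j} eq = contradiction (sym eq) (Fin.punchInᵢ≢i _ _)
permutation-injective (suc n) c {suc i} {zero}  eq = contradiction eq (Fin.punchInᵢ≢i _ _)
permutation-injective (suc n) c {suc i} {suc j} eq =
  cong suc (permutation-injective n (proj₂ (remQuot {suc n} (n !) c))
    (Fin.punchIn-injective (proj₁ (remQuot (n !) c)) _ _ eq))

permutation-faithful : ∀ n {c d} → permutation n c ≗ permutation n d → c ≡ d
permutation-faithful zero {zero} {zero} _ = refl
permutation-faithful (suc n) {c} {d} eq = begin
  c                             ≡⟨ Fin.combine-remQuot {suc n} (n !) c ⟨
  combine (proj₁ c′) (proj₂ c′) ≡⟨ cong₂ combine (eq zero) (permutation-faithful n tail) ⟩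
  combine (proj₁ d′) (proj₂ d′) ≡⟨ Fin.combine-remQuot {suc n} (n !) d ⟩
  d                             ∎
  where
  open ≡-Reasoning
  c′ d′ : Fin (suc n) × Fin (n !)
  c′ = remQuot (n !) c
  d′ = remQuot (n !) d
  tail : permutation n (proj₂ c′) ≗ permutation n (proj₂ d′)
  tail i = Fin.punchIn-injective (proj₁ c′) _ _
    (trans (eq (suc i)) (cong (λ q → punchIn q (permutation n (proj₂ d′) i)) (sym (eq zero))))

-- Boolean codes and numerical estimates

finToBool : Fin 2 → Bool
finToBool zero    = false
finToBool (suc _) = true

finToBool-injective : Injective _≡_ _≡_ finToBool
finToBool-injective {zero}     {zero}     _ = refl
finToBool-injective {suc zero} {suc zero} _ = refl

funToFin-cong : ∀ {m n} {f g : Fin m → Fin n} → f ≗ g → funToFin f ≡ funToFin g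
funToFin-cong {zero}  _  = refl
funToFin-cong {suc m} eq = cong₂ combine (eq zero) (funToFin-cong (eq ∘ suc))

if-not-injective : ∀ b {p q} → (if p then not b else b) ≡ (if q then not b else b) → p ≡ q
if-not-injective b     {true}  {true}  _ = refl
if-not-injective b     {false} {false} _ = refl
if-not-injective true  {true}  {false} ()
if-not-injective false {true}  {false} ()
if-not-injective true  {false} {true}  ()
if-not-injective false {false} {true}  ()

-- The `m` largest factors of `(m + n) !` all exceed `n`.
^≤! : ∀ m n → n ^ m ≤ (m + n) !
^≤! zero    n = ℕ.>-nonZero⁻¹ (n !) {{n ℕ.!≢0}}
^≤! (suc m) n = ℕ.*-mono-≤ (ℕ.m≤n⇒m≤1+n (ℕ.m≤n+m n m)) (^≤! m n)

n≤2^n : ∀ n → n ≤ 2 ^ n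
n≤2^n zero    = z≤n
n≤2^n (suc n) = ℕ.+-mono-≤ (ℕ.m^n>0 2 n) (ℕ.≤-trans (n≤2^n n) (ℕ.m≤m+n (2 ^ n) 0))

-- The left side counts pairs of a colouring and a quotient matrix. The number of vertices is
-- positive so that the exponent `k * k` can be absorbed into a multiple of it.
exponential-code-bound : ∀ k n → k ^ suc n * (2 ^ k) ^ k ≤ 2 ^ ((k + k * k) * suc n)
exponential-code-bound k n = begin
  k ^ suc n * (2 ^ k) ^ k
    ≤⟨ ℕ.*-monoˡ-≤ _ (ℕ.^-monoˡ-≤ (suc n) (n≤2^n k)) ⟩
  (2 ^ k) ^ suc n * (2 ^ k) ^ k
    ≡⟨ cong₂ _*_ (ℕ.^-*-assoc 2 k (suc n)) (ℕ.^-*-assoc 2 k k) ⟩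
  2 ^ (k * suc n) * 2 ^ (k * k)
    ≤⟨ ℕ.*-monoʳ-≤ (2 ^ (k * suc n)) (ℕ.^-monoʳ-≤ 2 (ℕ.m≤m*n (k * k) (suc n))) ⟩
  2 ^ (k * suc n) * 2 ^ (k * k * suc n)
    ≡⟨ ℕ.^-distribˡ-+-* 2 (k * suc n) _ ⟨
  2 ^ (k * suc n + k * k * suc n)
    ≡⟨ cong (2 ^_) (ℕ.*-distribʳ-+ (suc n) k (k * k)) ⟨
  2 ^ ((k + k * k) * suc n)
    ∎
  where open ℕ.≤-Reasoning

-- The left side counts triples of a dominant colour, a class table and a quotient matrix; `suc n`
-- includes the blank entry. From `2 ≤ n` on, `n` can replace the base 2, and its square bounds
-- `suc n`.
polynomial-code-bound : ∀ k m {n} → 2 ≤ n →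
  k * ((suc n ^ m) ^ k * (2 ^ k) ^ k) ≤ n ^ (k + (2 * (m * k) + k * k))
polynomial-code-bound k m {n@(suc n-1)} 2≤n = begin
  k * ((suc n ^ m) ^ k * (2 ^ k) ^ k)
    ≡⟨ cong₂ (λ p q → k * (p * q)) (ℕ.^-*-assoc (suc n) m k) (ℕ.^-*-assoc 2 k k) ⟩
  k * (suc n ^ (m * k) * 2 ^ (k * k))
    ≤⟨ ℕ.*-mono-≤ (ℕ.≤-trans (n≤2^n k) (ℕ.^-monoˡ-≤ k 2≤n))
         (ℕ.*-mono-≤ (ℕ.^-monoˡ-≤ (m * k) 1+n≤n²) (ℕ.^-monoˡ-≤ (k * k) 2≤n)) ⟩
  n ^ k * ((n ^ 2) ^ (m * k) * n ^ (k * k))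
    ≡⟨ cong (λ p → n ^ k * (p * n ^ (k * k))) (ℕ.^-*-assoc n 2 (m * k)) ⟩
  n ^ k * (n ^ (2 * (m * k)) * n ^ (k * k))
    ≡⟨ cong (n ^ k *_) (ℕ.^-distribˡ-+-* n (2 * (m * k)) (k * k)) ⟨
  n ^ k * n ^ (2 * (m * k) + k * k)
    ≡⟨ ℕ.^-distribˡ-+-* n k _ ⟨
  n ^ (k + (2 * (m * k) + k * k))
    ∎
  where
  open ℕ.≤-Reasoning
  1+n≤n² : suc n ≤ n ^ 2
  1+n≤n² = begin
    1 + n       ≤⟨ ℕ.+-monoˡ-≤ n (s≤s z≤n) ⟩
    n + n       ≡⟨ cong (n +_) (ℕ.+-identityʳ n) ⟨
    2 * n       ≤⟨ ℕ.*-monoˡ-≤ n 2≤n ⟩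
    n * n       ≡⟨ cong (n *_) (ℕ.*-identityʳ n) ⟨
    n ^ 2       ∎

-- Bounding the speed by codes and embeddings

module Speed {ℓ} (P : GraphProperty ℓ) (hereditary : Hereditary P)
             {s : ℕ → ℕ} (speed : IsSpeed P s) where

  open module Members {n} = Inverse (speed n) using (to; from; from-cong; strictlyInverseˡ; strictlyInverseʳ)

  -- The code may depend on the membership proof, because only equality of codes has to force
  -- equality of graphs.
  speed≤ : ∀ {n N} (code : (G : Graph n) → G ∈ᴾ P → Fin N) →
           (∀ {G H} p q → code G p ≡ code H q → G ≈ᴳ H) → s n ≤ N
  speed≤ code injective = Fin.injective⇒≤ {f = λ i → code _ (proj₂ (to i))} λ {i} {j} eq →
    trans (sym (strictlyInverseʳ i))
      (trans (from-cong (injective (proj₂ (to i)) (proj₂ (to j)) eq)) (strictlyInverseʳ j))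

  -- Heredity puts every `G [ φ i ]` into `P`, so a single member supplies all the labelled graphs
  -- counted.
  speed≥ : ∀ {m n N} {G : Graph n} → G ∈ᴾ P →
           (φ : Fin N → Fin m ↣ Fin n) →
           (∀ {i j} → (G [ φ i ]) ≈ᴳ (G [ φ j ]) → i ≡ j) → N ≤ s m
  speed≥ {G = G} G∈P φ injective =
    Fin.injective⇒≤ {f = λ i → from (member i)} λ {i} {j} eq → injective λ x y →
      trans (sym (strictlyInverseˡ (member i) x y))
        (trans (cong (λ k → adj (proj₁ (to k)) x y) eq) (strictlyInverseˡ (member j) x y))
    where
    member : ∀ i → Σ[ H ∈ Graph _ ] H ∈ᴾ P
    member i = (G [ φ i ]) , hereditary G (φ i) G∈P

  -- Lower bounds from a single vertex

  module _ {n m N} {G : Graph n} {z b} (G∈P : G ∈ᴾ P) (B : Fan G z b m)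
           (A : Fin m → Fin n) (A≢z : ∀ t → A t ≢ z) (adj-A : ∀ t → adj G z (A t) ≡ not b)
           (select : Fin N → Fin m → Bool)
           (A-injective : ∀ i {t u} → select i t ≡ true → select i u ≡ true → A t ≡ A u → t ≡ u)
           (select-faithful : ∀ {i j} → select i ≗ select j → i ≡ j) where

    choice : Fin N → Fin m → Fin n
    choice i t = if select i t then A t else tip B t

    adj-choice : ∀ i t → adj G z (choice i t) ≡ (if select i t then not b else b)
    adj-choice i t with select i t
    ... | true  = adj-A t
    ... | false = adj-tip B t

    choice≢ : ∀ i t → choice i t ≢ z
    choice≢ i t with select i t
    ... | true  = A≢z t
    ... | false = tip≢ B t

    choice-injective : ∀ i → Injective _≡_ _≡_ (choice i)
    choice-injective i {t} {u} eq with select i t in t? | select i u in u?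
    ... | true  | true  = A-injective i t? u? eq
    ... | false | false = injective B eq
    ... | true  | false = contradiction
      (trans (sym (adj-tip B u)) (trans (cong (adj G z) (sym eq)) (adj-A t))) (Bool.not-¬ refl)
    ... | false | true  = contradiction
      (trans (sym (adj-tip B t)) (trans (cong (adj G z) eq) (adj-A u))) (Bool.not-¬ refl)

    -- The label `zero` goes to `z`, so its row in the induced graph spells out the selection. Since
    -- `A` is injective only on selected positions, it may be constant when one position is selected
    -- at a time.
    selections≤speed : N ≤ s (suc m)
    selections≤speed = speed≥ G∈P (λ i → mk↣ (embedding-injective i)) λ {i} {j} eq →
      select-faithful λ t → if-not-injective b
        (trans (sym (adj-choice i t)) (trans (eq zero (suc t)) (adj-choice j t)))
      where
      embedding-injective : ∀ i → Injective _≡_ _≡_ (z ◂ choice i)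
      embedding-injective i {zero}  {zero}  _  = refl
      embedding-injective i {zero}  {suc u} eq = contradiction (sym eq) (choice≢ i u)
      embedding-injective i {suc t} {zero}  eq = contradiction eq (choice≢ i t)
      embedding-injective i {suc t} {suc u} eq = cong suc (choice-injective i eq)

  twoFans⇒speed : ∀ {n m} {G : Graph n} → G ∈ᴾ P → TwoFans G m → 2 ^ m ≤ s (suc m)
  twoFans⇒speed {m = m} G∈P (z , b , B , A) =
    selections≤speed G∈P B (tip A) (tip≢ A) (adj-tip A)
      (λ i t → finToBool (finToFun i t)) (λ _ _ _ → injective A)
      λ {i} {j} eq → trans (sym (Fin.funToFin-finToFin {m} i)) (trans
        (funToFin-cong (λ t → finToBool-injective (eq t))) (Fin.funToFin-finToFin {m} j))

  -- Replacing the `i`-th tip of a fan by one vertex `v` of opposite adjacency gives a different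
  -- labelled graph for each `i`.
  distinguished⇒speed : ∀ {n m} {G : Graph n} {x y z} → G ∈ᴾ P → m + m < n →
                        Distinguishes G x y z → m ≤ s (suc m)
  distinguished⇒speed {m = m} {G} G∈P 2m<n d
    with b , B , v , v≢z , adj-v ← distinguished⇒fan {m = m} {G} 2m<n d
    = selections≤speed G∈P B (λ _ → v) (λ _ → v≢z) (λ _ → adj-v) (λ i t → does (i Fin.≟ t))
        (λ i t? u? _ → trans (sym (does≡ {i} t?)) (does≡ u?))
        λ {i} {j} eq → sym (does≡ (trans (sym (eq i)) (dec-true (i Fin.≟ i) refl)))
    where
    does≡ : ∀ {i j : Fin m} → does (i Fin.≟ j) ≡ true → i ≡ j
    does≡ {i} {j} eq with yes p ← i Fin.≟ j = p

  -- Factorial lower bound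

  -- The first `m` labels go to the `y` in order, the others to the permuted `x`. Adjacency to the
  -- `y` identifies each `x`, because of two of them the earlier one is separated from the other by
  -- its own `y`; hence the permutation can be recovered.
  separated⇒speed : ∀ {n m} {G : Graph n} {S} → G ∈ᴾ P → Separated G S m → m ! ≤ s (m + m)
  separated⇒speed {n} {m} {G} G∈P sep =
    speed≥ G∈P (λ c → mk↣ (embedding-injective c)) λ {c} {d} eq →
      permutation-faithful m λ t → recover λ u →
        trans (sym (adj-embed c u t)) (trans (eq (u ↑ˡ m) (m ↑ʳ t)) (adj-embed d u t))
    where
    open Separated sep

    place : Fin (m !) → Fin m ⊎ Fin m → Fin n
    place c = [ y , x ∘ permutation m c ]′

    embed : Fin (m !) → Fin (m + m) → Fin n
    embed c = place c ∘ splitAt m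

    place-injective : ∀ c → Injective _≡_ _≡_ (place c)
    place-injective c {inj₁ i} {inj₁ j} eq = cong inj₁ (y-injective eq)
    place-injective c {inj₁ i} {inj₂ j} eq = contradiction eq (y≢x i _)
    place-injective c {inj₂ i} {inj₁ j} eq = contradiction (sym eq) (y≢x j _)
    place-injective c {inj₂ i} {inj₂ j} eq = cong inj₂ (permutation-injective m c (x-injective eq))

    embedding-injective : ∀ c → Injective _≡_ _≡_ (embed c)
    embedding-injective c {i} {j} eq = trans (sym (Fin.join-splitAt m m i))
      (trans (cong (Fin.join m m) (place-injective c {splitAt m i} {splitAt m j} eq))
        (Fin.join-splitAt m m j))

    adj-embed : ∀ c u t →
                adj G (embed c (u ↑ˡ m)) (embed c (m ↑ʳ t)) ≡ adj G (y u) (x (permutation m c t))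
    adj-embed c u t = cong₂ (λ p q → adj G (place c p) (place c q))
      (Fin.splitAt-↑ˡ m u m) (Fin.splitAt-↑ʳ m m t)

    recover : ∀ {i j} → (∀ u → adj G (y u) (x i) ≡ adj G (y u) (x j)) → i ≡ j
    recover {i} {j} eq with Fin.<-cmp i j
    ... | tri< i<j _ _ = contradiction (eq i) (separates i<j)
    ... | tri≈ _ i≡j _ = i≡j
    ... | tri> _ _ j<i = contradiction (sym (eq j)) (separates j<i)

  neighbourhood-diversity⇒speed : ∀ {n m} {G : Graph n} → G ∈ᴾ P → separableSize m ≤ nd G → m ! ≤ s (m + m)
  neighbourhood-diversity⇒speed {m = m} {G} G∈P large =
    separated⇒speed G∈P (separate G m (representatives G) (representatives-dissimilar G) large)

  -- Positive speed and the constant layer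

  membersBelow : ℕ → List (∃ Graph)
  membersBelow zero    = []
  membersBelow (suc n) = map (λ i → n , proj₁ (to i)) (allFin (s n)) ++ membersBelow n

  membersBelow-complete : ∀ {m n} {G : Graph m} → G ∈ᴾ P → m ℕ.<′ n →
                          Any (λ (_ , H) → G ≅ H) (membersBelow n)
  membersBelow-complete {m} {G = G} G∈P ℕ.≤′-refl =
    Any.++⁺ˡ (Any.map⁺ (Any.map (λ { refl → ≅-of-≈ᴳ λ x y → sym (strictlyInverseˡ (G , G∈P) x y) })
      (∈-allFin (from (G , G∈P)))))
  membersBelow-complete G∈P (ℕ.≤′-step {n} m<n) =
    Any.++⁺ʳ (map (λ i → n , proj₁ (to i)) (allFin (s n))) (membersBelow-complete G∈P m<n)

  -- If no member had `n` vertices, heredity would exclude all larger ones, and the finite list of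
  -- smaller members would contradict `infinite`.
  speed-positive : ∀ n → 0 < s n
  speed-positive n = ℕ.n≢0⇒n>0 λ empty → infinite P (membersBelow n , λ {m} G G∈P →
    membersBelow-complete G∈P (ℕ.<⇒<′ (ℕ.≰⇒> λ n≤m → Fin.¬Fin0 (subst Fin empty
      (from (_ , hereditary G (mk↣ (Fin.inject≤-injective n≤m n≤m _ _)) G∈P))))))

  -- By `distinguished⇒speed`, members with more than `m + m` vertices have no distinguished pair.
  -- They are therefore complete or edgeless, and the pair of the first two vertices decides which.
  slow⇒constant : ∀ {m} → ¬ m ≤ s (suc m) → ConstantSpeed s
  slow⇒constant {m} slow = 1 , 2 , s≤s z≤n , s≤s z≤n , 2 + (m + m) , λ n N≤n →
    ℕ.≤-trans (speed-positive n) (ℕ.≤-reflexive (sym (ℕ.*-identityˡ (s n)))) , bound N≤n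
    where
    bound : ∀ {n} → 2 + (m + m) ≤ n → s n ≤ 2
    bound {suc zero} (s≤s ())
    bound {suc (suc n)} N≤n = speed≤ (λ G _ → boolToFin (adj G zero (suc zero)))
      λ {G} {H} G∈P H∈P eq x y → homogeneous G∈P H∈P (boolToFin-injective eq) x y
      where
      all-similar : ∀ {G : Graph (2 + n)} → G ∈ᴾ P → ∀ {x y} → Similar G x y
      all-similar G∈P (_ , d) = slow (distinguished⇒speed G∈P (ℕ.<⇒≤ N≤n) d)

      homogeneous : ∀ {G H : Graph (2 + n)} → G ∈ᴾ P → H ∈ᴾ P →
                    adj G zero (suc zero) ≡ adj H zero (suc zero) → G ≈ᴳ H
      homogeneous {G} {H} G∈P H∈P eq x y with x Fin.≟ y
      ... | yes refl = trans (loopless G x) (sym (loopless H x))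
      ... | no x≢y   = trans (similar-adj G (all-similar G∈P) (all-similar G∈P) x≢y λ ())
        (trans eq (similar-adj H (all-similar H∈P) (all-similar H∈P) (λ ()) x≢y))

  -- Speeds under bounded diversity

  module _ {k} (nd≤k : ∀ {n} (G : Graph n) → G ∈ᴾ P → nd G ≤ k) where

    exponential-upper : ∀ n → s (suc n) ≤ 2 ^ ((k + k * k) * suc n)
    exponential-upper n = ℕ.≤-trans (speed≤ code code-injective) (exponential-code-bound k n)
      where
      colouring : (G : Graph (suc n)) → G ∈ᴾ P → ClassColouring k G
      colouring G G∈P = classColouring G (nd≤k G G∈P)

      code : (G : Graph (suc n)) → G ∈ᴾ P → Fin (k ^ suc n * (2 ^ k) ^ k)
      code G G∈P = combine (funToFin (colour (colouring G G∈P))) (quotientCode (colouring G G∈P))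

      code-injective : ∀ {G H} G∈P H∈P → code G G∈P ≡ code H H∈P → G ≈ᴳ H
      code-injective G∈P H∈P eq with eq₁ , eq₂ ← Fin.combine-injective _ _ _ _ eq =
        quotient-determines (colouring _ G∈P) (colouring _ H∈P)
          (funToFin-injective eq₁) (quotientCode-injective (colouring _ G∈P) (colouring _ H∈P) eq₂)

    polynomial-upper : ∀ {m} → ¬ 2 ^ m ≤ s (suc m) → ∀ {n} → 2 ≤ n →
                       s n ≤ n ^ (k + (2 * (m * k) + k * k))
    polynomial-upper {m} slow {n} 2≤n =
      ℕ.≤-trans (speed≤ code code-injective) (polynomial-code-bound k m 2≤n)
      where
      module _ (G : Graph n) (G∈P : G ∈ᴾ P) where
        colouring : ClassColouring k G
        colouring = classColouring G (nd≤k G G∈P)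

        dominant : ∃[ big ] SmallApartFrom colouring big m
        dominant = dominant-class (ℕ.<⇒≤ 2≤n) (slow ∘ twoFans⇒speed G∈P) colouring

        code : Fin (k * ((suc n ^ m) ^ k * (2 ^ k) ^ k))
        -- The dominant colour belongs to the code because `classTable-determines` needs the same
        -- one for both graphs.
        code = combine (proj₁ dominant)
          (combine (matrixToFin (classTable colouring m)) (quotientCode colouring))

      code-injective : ∀ {G H} G∈P H∈P → code G G∈P ≡ code H H∈P → G ≈ᴳ H
      code-injective {G} {H} G∈P H∈P eq
        with big≡ , eq′ ← Fin.combine-injective _ _ _ _ eq
        with table≡ , quotient≡ ← Fin.combine-injective _ _ _ _ eq′ =
        quotient-determines C D
          (classTable-determines C D (proj₂ (dominant G G∈P))
            (subst (λ big → SmallApartFrom D big m) (sym big≡) (proj₂ (dominant H H∈P)))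
            (matrixToFin-injective table≡))
          (quotientCode-injective C D quotient≡)
        where
        C = colouring G G∈P
        D = colouring H H∈P

    slow⇒polynomial : (∀ m → m ≤ s (suc m)) → ∀ {m} → ¬ 2 ^ m ≤ s (suc m) → PolynomialSpeed s
    slow⇒polynomial linear {m} slow =
      -- From 3 on, `n ≤ (n ∸ 1) ^ 2`, which turns the linear lower bound into the exponent 2. The
      -- `suc` makes the upper constant positive even for `k = 0`.
      2 , suc (k + (2 * (m * k) + k * k)) , s≤s z≤n , s≤s z≤n , 3 , λ n 3≤n → lower 3≤n , upper 3≤n
      where
      upper : ∀ {n} → 3 ≤ n → s n ≤ n ^ (suc (k + (2 * (m * k) + k * k)) * 1)
      upper {n@(suc _)} 3≤n = ℕ.≤-trans (polynomial-upper slow (ℕ.<⇒≤ 3≤n))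
        (ℕ.^-monoʳ-≤ n (ℕ.≤-trans (ℕ.n≤1+n (k + (2 * (m * k) + k * k)))
          (ℕ.≤-reflexive (sym (ℕ.*-identityʳ (suc (k + (2 * (m * k) + k * k))))))))

      lower : ∀ {n} → 3 ≤ n → n ^ 1 ≤ s n ^ 2
      lower {suc n} (s≤s 2≤n) = begin
        suc n ^ 1    ≡⟨ ℕ.^-identityʳ (suc n) ⟩
        1 + n        ≤⟨ ℕ.+-monoˡ-≤ n (ℕ.<⇒≤ 2≤n) ⟩
        n + n        ≡⟨ cong (n +_) (ℕ.+-identityʳ n) ⟨
        2 * n        ≤⟨ ℕ.*-monoˡ-≤ n 2≤n ⟩
        n * n        ≡⟨ cong (n *_) (ℕ.*-identityʳ n) ⟨
        n ^ 2        ≤⟨ ℕ.^-monoˡ-≤ 2 (linear n) ⟩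
        s (suc n) ^ 2 ∎
        where open ℕ.≤-Reasoning

    exponential : ¬ ConstantSpeed s → ¬ PolynomialSpeed s → ExponentialSpeed s
    exponential ¬constant ¬polynomial =
      -- The lower constant 2 comes from `n ≤ 2 * (n ∸ 1)`, valid from 2 on.
      2 , suc (k + k * k) , s≤s z≤n , s≤s z≤n , 2 , λ n 2≤n → lower 2≤n , upper 2≤n
      where
      linear : ∀ m → m ≤ s (suc m)
      -- Since `≤` on numbers is decidable, the negated speed hypotheses yield actual inequalities.
      linear m = decidable-stable (m ℕ.≤? _) (¬constant ∘ slow⇒constant)

      fast : ∀ m → 2 ^ m ≤ s (suc m)
      fast m = decidable-stable (_ ℕ.≤? _) (¬polynomial ∘ slow⇒polynomial linear)

      lower : ∀ {n} → 2 ≤ n → 2 ^ n ≤ s n ^ 2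
      lower {suc n} (s≤s 1≤n) = begin
        2 ^ (1 + n)     ≤⟨ ℕ.^-monoʳ-≤ 2 (ℕ.+-monoˡ-≤ n 1≤n) ⟩
        2 ^ (n + n)     ≡⟨ cong (λ m → 2 ^ (n + m)) (ℕ.+-identityʳ n) ⟨
        2 ^ (2 * n)     ≡⟨ cong (2 ^_) (ℕ.*-comm 2 n) ⟩
        2 ^ (n * 2)     ≡⟨ ℕ.^-*-assoc 2 n 2 ⟨
        (2 ^ n) ^ 2     ≤⟨ ℕ.^-monoˡ-≤ 2 (fast n) ⟩
        s (suc n) ^ 2   ∎
        where open ℕ.≤-Reasoning

      upper : ∀ {n} → 2 ≤ n → s n ≤ 2 ^ (suc (k + k * k) * n)
      upper {suc n} _ = ℕ.≤-trans (exponential-upper n)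
        (ℕ.^-monoʳ-≤ 2 (ℕ.*-monoˡ-≤ (suc n) (ℕ.n≤1+n (k + k * k))))

  -- Exponential speed bounds the diversity

  -- Larger diversity would force `(B + B) !` labelled graphs on four times `B` vertices, more than
  -- the exponential bound allows.
  bounded-diversity : ExponentialSpeed s → ∃[ k ] (∀ {n} (G : Graph n) → G ∈ᴾ P → nd G ≤ k)
  bounded-diversity (_ , c , _ , _ , N , bounds) = separableSize (B + B) , λ G G∈P →
    ℕ.≮⇒≥ λ large → ℕ.<⇒≱ too-fast (neighbourhood-diversity⇒speed G∈P (ℕ.<⇒≤ large))
    where
    B : ℕ
    -- Exceeding `2 ^ (c * 4)` makes `B ^ B` beat the exponential bound; exceeding `N` makes that
    -- bound applicable.
    B = suc (2 ^ (c * 4) + N)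

    too-fast : s ((B + B) + (B + B)) < (B + B) !
    too-fast = begin-strict
      s ((B + B) + (B + B))           ≤⟨ proj₂ (bounds _ N≤4B) ⟩
      2 ^ (c * ((B + B) + (B + B)))   ≡⟨ cong (2 ^_) (quadruple c B) ⟩
      2 ^ (c * 4 * B)                 ≡⟨ ℕ.^-*-assoc 2 (c * 4) B ⟨
      (2 ^ (c * 4)) ^ B               <⟨ ℕ.^-monoˡ-< B (s≤s (ℕ.m≤m+n (2 ^ (c * 4)) N)) ⟩
      B ^ B                           ≤⟨ ^≤! B B ⟩
      (B + B) !                       ∎
      where
      open ℕ.≤-Reasoning
      quadruple : ∀ c B → c * ((B + B) + (B + B)) ≡ c * 4 * B
      quadruple = solve-∀
      N≤4B : N ≤ (B + B) + (B + B)
      N≤4B = begin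
        N                     ≤⟨ ℕ.m≤n+m N (suc (2 ^ (c * 4))) ⟩
        B                     ≤⟨ ℕ.m≤m+n B B ⟩
        B + B                 ≤⟨ ℕ.m≤m+n (B + B) (B + B) ⟩
        (B + B) + (B + B)     ∎

theorem16 : ∀ {ℓ} (P : GraphProperty ℓ) → Hereditary P →
    (s : ℕ → ℕ) → IsSpeed P s →
    ¬ ConstantSpeed s → ¬ PolynomialSpeed s →
    ExponentialSpeed s ⇔
    (∃[ k ] (∀ {n} (G : Graph n) → G ∈ᴾ P → nd G ≤ k))
theorem16 P hereditary s speed ¬constant ¬polynomial = mk⇔ bounded-diversity
  λ (k , nd≤k) → exponential nd≤k ¬constant ¬polynomial
  where open Speed P hereditary speed
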